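{- For every $\epsilon>0$ there exist constants $c>0$, $C>0$ and $d_0$ (independent of $d$) such that for every $d\ge d_0$ there is a bipartite graph $G=(V,W,E)$ which contains no $K_{2,2}$ as a subgraph, has average degree at least $c\,d^{1-\epsilon}$, and has a conjunctive normal form using at most $C\log d$ clauses.
   Context: A bipartite graph over vertex sets $V$ and $W$ is $G=(V,W,E)$ with $E\subset V\times W$. For two bipartite graphs $G_1=(V,W,E_1)$, $G_2=(V,W,E_2)$ over the same $V,W$, the intersection is $G_1\cap G_2=(V,W,E_1\cap E_2)$, and intersections of families are defined edge-setwise likewise. For $A\subset V$ and $B\subset W$, the clause graph is $CL(A,B)=(V,W,(A\times W)\cup(V\times B))$. Sets $A_1,\dots,A_n\subset V$ and $B_1,\dots,B_n\subset W$ form a conjunctive normal form using $n$ clauses for a graph $G$ over $V$ and $W$ if $G=\bigcap_{i=1}^n CL(A_i,B_i)$. -}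

module Defs where

open import Data.Nat using (ℕ; zero; suc; _+_; _*_; _^_; _≤_)
open import Data.Bool using (Bool; true; false; _∨_; _∧_; if_then_else_)
open import Data.Fin using (Fin; zero; suc)
open import Data.Product using (_×_; Σ-syntax)
open import Relation.Binary.PropositionalEquality using (_≡_; _≢_)
open import Relation.Nullary using (¬_)

BipGraph : ℕ → ℕ → Set
BipGraph m n = Fin m → Fin n → Bool

SubsetOf : ℕ → Set
SubsetOf m = Fin m → Bool

sumFin : (k : ℕ) → (Fin k → ℕ) → ℕ
sumFin zero    f = 0
sumFin (suc k) f = f zero + sumFin k (λ i → f (suc i))

allFin : (k : ℕ) → (Fin k → Bool) → Bool
allFin zero    f = true
allFin (suc k) f = f zero ∧ allFin k (λ i → f (suc i))

numEdges : ∀ {m n} → BipGraph m n → ℕ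
numEdges {m} {n} G = sumFin m (λ v → sumFin n (λ w → if G v w then 1 else 0))

-- Clause graph CL(A,B) = (V, W, (A × W) ∪ (V × B)).
CL : ∀ {m n} → SubsetOf m → SubsetOf n → BipGraph m n
CL A B v w = A v ∨ B w

⋂ : ∀ {m n} (k : ℕ) → (Fin k → BipGraph m n) → BipGraph m n
⋂ k Gs v w = allFin k (λ i → Gs i v w)

IsCNF : ∀ {m n} (G : BipGraph m n) (k : ℕ) → (Fin k → SubsetOf m) → (Fin k → SubsetOf n) → Set
IsCNF G k A B = ∀ v w → G v w ≡ ⋂ k (λ i → CL (A i) (B i)) v w

HasCNF : ∀ {m n} → BipGraph m n → ℕ → Set
HasCNF {m} {n} G k = Σ[ A ∈ (Fin k → SubsetOf m) ] Σ[ B ∈ (Fin k → SubsetOf n) ] IsCNF G k A B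

K22Free : ∀ {m n} → BipGraph m n → Set
K22Free {m} {n} G =
  ∀ (v₁ v₂ : Fin m) (w₁ w₂ : Fin n) → v₁ ≢ v₂ → w₁ ≢ w₂ →
  ¬ (G v₁ w₁ ≡ true × G v₁ w₂ ≡ true × G v₂ w₁ ≡ true × G v₂ w₂ ≡ true)

{-# OPTIONS --safe #-}
module Submission where

-- The constant C may depend on ε, so it suffices to build, for every u, a K₂,₂-free graph of
-- average degree at least 2ᵘ with a CNF of O(u) clauses.  For random colourings f, g of the two
-- sides by three colours, the graph f(v) ≠ g(w) is an intersection of three clause graphs; it
-- contains a given edge with probability 18/27, a given square (K₂,₂) with probability 6/27 and a
-- given square with a pendant edge with probability 4/27.  Intersect r such graphs on
-- N + N vertices, choosing each colouring so that a linear combination of the three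
-- counts is no worse than on average.  One last clause isolates all left vertices lying
-- on a square, which destroys every square and costs at most (squares with a pendant edge) +
-- 2 (squares) edges.  Since 4/27 is so small, N may grow exponentially in r with N (2/3)ʳ
-- exponential as well, and most edges survive.

open import Defs
open import Data.Bool using (Bool; true; false; _∨_; _∧_; not; if_then_else_)
open import Data.Bool.Properties using (∧-comm)
open import Data.Fin using (Fin; zero; suc; _≟_)
open import Data.Fin.Patterns using (0F; 1F; 2F)
open import Data.List using (List; []; _∷_)
open import Data.Nat using (ℕ; zero; suc; _+_; _*_; _^_; _≤_; _<_; z≤n; s≤s; _≤?_; _≡ᵇ_; NonZero; >-nonZero)
open import Data.Nat.Properties hiding (_≟_; _≤?_)
open import Data.Nat.Tactic.RingSolver using (solve-∀)
open import Data.Product using (_×_; _,_; Σ-syntax; ∃-syntax)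
open import Data.Vec using (Vec; []; _∷_; lookup; map; _[_]≔_)
open import Data.Vec.Properties using (lookup∘update; lookup∘update′; lookup-map)
open import Data.Vec.Relation.Unary.All using (All; []; _∷_)
open import Data.Vec.Relation.Unary.AllPairs as AllPairs using ([]; _∷_; allPairs?)
open import Data.Vec.Relation.Unary.Unique.Propositional using (Unique)
open import Relation.Binary.PropositionalEquality
  using (_≡_; _≢_; refl; sym; trans; cong; cong₂; subst; subst₂; module ≡-Reasoning)
open import Relation.Nullary using (Dec; yes; no; does; ¬?; contradiction)
open import Relation.Nullary.Decidable using (dec-true; does-⇔)
open import Function.Bundles using (mk⇔)

private
  variable
    k l m n N : ℕ

ι : Bool → ℕ
ι b = if b then 1 else 0

ι-∧ : ∀ a b → ι (a ∧ b) ≡ ι a * ι b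
ι-∧ true  b = sym (+-identityʳ (ι b))
ι-∧ false b = refl

ι≤1 : ∀ b → ι b ≤ 1
ι≤1 true  = ≤-refl
ι≤1 false = z≤n

-- Finite sums

sumFin-cong : {F G : Fin k → ℕ} → (∀ i → F i ≡ G i) → sumFin k F ≡ sumFin k G
sumFin-cong {zero}  F≡G = refl
sumFin-cong {suc k} F≡G = cong₂ _+_ (F≡G zero) (sumFin-cong (λ i → F≡G (suc i)))

sumFin-mono : {F G : Fin k → ℕ} → (∀ i → F i ≤ G i) → sumFin k F ≤ sumFin k G
sumFin-mono {zero}  F≤G = z≤n
sumFin-mono {suc k} F≤G = +-mono-≤ (F≤G zero) (sumFin-mono (λ i → F≤G (suc i)))

+-interchange : ∀ a b c d → (a + b) + (c + d) ≡ (a + c) + (b + d)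
+-interchange = solve-∀

sumFin-+ : (F G : Fin k → ℕ) → sumFin k (λ i → F i + G i) ≡ sumFin k F + sumFin k G
sumFin-+ {zero}  F G = refl
sumFin-+ {suc k} F G = trans
  (cong (F zero + G zero +_) (sumFin-+ (λ i → F (suc i)) (λ i → G (suc i))))
  (+-interchange (F zero) (G zero) _ _)

sumFin-*ˡ : ∀ c (F : Fin k → ℕ) → sumFin k (λ i → c * F i) ≡ c * sumFin k F
sumFin-*ˡ {zero}  c F = sym (*-zeroʳ c)
sumFin-*ˡ {suc k} c F = trans
  (cong (c * F zero +_) (sumFin-*ˡ c (λ i → F (suc i))))
  (sym (*-distribˡ-+ c (F zero) _))

sumFin-const : ∀ k c → sumFin k (λ _ → c) ≡ k * c
sumFin-const zero    c = refl
sumFin-const (suc k) c = cong (c +_) (sumFin-const k c)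

term≤sumFin : (F : Fin k → ℕ) (i : Fin k) → F i ≤ sumFin k F
term≤sumFin F zero    = m≤m+n _ _
term≤sumFin F (suc i) = ≤-trans (term≤sumFin (λ j → F (suc j)) i) (m≤n+m _ _)

-- First moment principle: an index where `F` exceeds `G` can be discarded without spoiling the
-- comparison of the remaining sums, so some index must satisfy the inequality.
sumFin-≤⇒∃ : (F G : Fin (suc k) → ℕ) → sumFin (suc k) F ≤ sumFin (suc k) G → ∃[ i ] F i ≤ G i
sumFin-≤⇒∃ {zero}  F G ΣF≤ΣG = zero , subst₂ _≤_ (+-identityʳ _) (+-identityʳ _) ΣF≤ΣG
sumFin-≤⇒∃ {suc k} F G ΣF≤ΣG with F zero ≤? G zero
... | yes F≤G = zero , F≤G
... | no  F≰G =
  let i , p = sumFin-≤⇒∃ (λ i → F (suc i)) (λ i → G (suc i))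
                (+-cancelˡ-≤ (G zero) _ _ (≤-trans (+-monoˡ-≤ _ (≰⇒≥ F≰G)) ΣF≤ΣG))
  in suc i , p

-- Vectors encode functions from `Fin n` to `Fin k`. The same sum serves for all colourings of the
-- vertices (`k` = 3) and for all tuples of vertices (`n` small).
sumVec : (k n : ℕ) → (Vec (Fin k) n → ℕ) → ℕ
sumVec k zero    F = F []
sumVec k (suc n) F = sumFin k (λ a → sumVec k n (λ x → F (a ∷ x)))

sumVec-cong : {F G : Vec (Fin k) n → ℕ} → (∀ x → F x ≡ G x) → sumVec k n F ≡ sumVec k n G
sumVec-cong {n = zero}  F≡G = F≡G []
sumVec-cong {n = suc n} F≡G = sumFin-cong (λ a → sumVec-cong (λ x → F≡G (a ∷ x)))

sumVec-mono : {F G : Vec (Fin k) n → ℕ} → (∀ x → F x ≤ G x) → sumVec k n F ≤ sumVec k n G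
sumVec-mono {n = zero}  F≤G = F≤G []
sumVec-mono {n = suc n} F≤G = sumFin-mono (λ a → sumVec-mono (λ x → F≤G (a ∷ x)))

sumVec-+ : (F G : Vec (Fin k) n → ℕ) →
  sumVec k n (λ x → F x + G x) ≡ sumVec k n F + sumVec k n G
sumVec-+ {n = zero}  F G = refl
sumVec-+ {k} {suc n} F G = trans
  (sumFin-cong (λ a → sumVec-+ (λ x → F (a ∷ x)) (λ x → G (a ∷ x))))
  (sumFin-+ {k} _ _)

sumVec-*ˡ : ∀ c (F : Vec (Fin k) n → ℕ) → sumVec k n (λ x → c * F x) ≡ c * sumVec k n F
sumVec-*ˡ {n = zero}  c F = refl
sumVec-*ˡ {k} {suc n} c F = trans
  (sumFin-cong (λ a → sumVec-*ˡ c (λ x → F (a ∷ x))))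
  (sumFin-*ˡ {k} c _)

sumVec-const : ∀ k n c → sumVec k n (λ _ → c) ≡ k ^ n * c
sumVec-const k zero    c = sym (+-identityʳ c)
sumVec-const k (suc n) c = begin
  sumFin k (λ _ → sumVec k n (λ _ → c)) ≡⟨ sumFin-const k _ ⟩
  k * sumVec k n (λ _ → c)              ≡⟨ cong (k *_) (sumVec-const k n c) ⟩
  k * (k ^ n * c)                       ≡⟨ *-assoc k (k ^ n) c ⟨
  k * k ^ n * c                         ∎
  where open ≡-Reasoning

term≤sumVec : (F : Vec (Fin k) n → ℕ) (x : Vec (Fin k) n) → F x ≤ sumVec k n F
term≤sumVec F []      = ≤-refl
term≤sumVec F (a ∷ x) = ≤-trans (term≤sumVec (λ y → F (a ∷ y)) x) (term≤sumFin _ a)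

sumVec-≤⇒∃ : (F G : Vec (Fin (suc k)) n → ℕ) →
  sumVec (suc k) n F ≤ sumVec (suc k) n G → ∃[ x ] F x ≤ G x
sumVec-≤⇒∃ {n = zero}  F G ΣF≤ΣG = [] , ΣF≤ΣG
sumVec-≤⇒∃ {n = suc n} F G ΣF≤ΣG =
  let a , p = sumFin-≤⇒∃ (λ a → sumVec _ n (λ x → F (a ∷ x))) (λ a → sumVec _ n (λ x → G (a ∷ x))) ΣF≤ΣG
      x , q = sumVec-≤⇒∃ (λ x → F (a ∷ x)) (λ x → G (a ∷ x)) p
  in a ∷ x , q

sumFin-sumVec-swap : (F : Fin k → Vec (Fin l) n → ℕ) →
  sumFin k (λ a → sumVec l n (F a)) ≡ sumVec l n (λ x → sumFin k (λ a → F a x))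
sumFin-sumVec-swap {zero} {l} {n} F = sym (trans (sumVec-const l n 0) (*-zeroʳ (l ^ n)))
sumFin-sumVec-swap {suc k} F = trans
  (cong (sumVec _ _ (F zero) +_) (sumFin-sumVec-swap (λ a → F (suc a))))
  (sym (sumVec-+ (F zero) _))

sumVec-swap : (F : Vec (Fin k) m → Vec (Fin l) n → ℕ) →
  sumVec k m (λ x → sumVec l n (F x)) ≡ sumVec l n (λ y → sumVec k m (λ x → F x y))
sumVec-swap {k} {zero}  F = refl
sumVec-swap {k} {suc m} {l} {n} F = trans
  (sumFin-cong (λ a → sumVec-swap (λ x → F (a ∷ x))))
  (sumFin-sumVec-swap {k} {l} {n} _)

sum₂ : (k m n : ℕ) → (Vec (Fin k) m → Vec (Fin k) n → ℕ) → ℕ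
sum₂ k m n F = sumVec k m (λ x → sumVec k n (F x))

sum₂-cong : {F G : Vec (Fin k) m → Vec (Fin k) n → ℕ} →
  (∀ x y → F x y ≡ G x y) → sum₂ k m n F ≡ sum₂ k m n G
sum₂-cong F≡G = sumVec-cong (λ x → sumVec-cong (F≡G x))

sum₂-mono : {F G : Vec (Fin k) m → Vec (Fin k) n → ℕ} →
  (∀ x y → F x y ≤ G x y) → sum₂ k m n F ≤ sum₂ k m n G
sum₂-mono F≤G = sumVec-mono (λ x → sumVec-mono (F≤G x))

sum₂-+ : (F G : Vec (Fin k) m → Vec (Fin k) n → ℕ) →
  sum₂ k m n (λ x y → F x y + G x y) ≡ sum₂ k m n F + sum₂ k m n G
sum₂-+ {k} {m} F G = trans (sumVec-cong (λ x → sumVec-+ (F x) (G x))) (sumVec-+ {k} {m} _ _)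

sum₂-*ˡ : ∀ c (F : Vec (Fin k) m → Vec (Fin k) n → ℕ) →
  sum₂ k m n (λ x y → c * F x y) ≡ c * sum₂ k m n F
sum₂-*ˡ {k} {m} c F = trans (sumVec-cong (λ x → sumVec-*ˡ c (F x))) (sumVec-*ˡ {k} {m} c _)

sum₂-const : ∀ k m n c → sum₂ k m n (λ _ _ → c) ≡ k ^ m * k ^ n * c
sum₂-const k m n c = begin
  sumVec k m (λ _ → sumVec k n (λ _ → c)) ≡⟨ sumVec-const k m _ ⟩
  k ^ m * sumVec k n (λ _ → c)            ≡⟨ cong (k ^ m *_) (sumVec-const k n c) ⟩
  k ^ m * (k ^ n * c)                     ≡⟨ *-assoc (k ^ m) (k ^ n) c ⟨
  k ^ m * k ^ n * c                       ∎
  where open ≡-Reasoning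

-- Linearity of expectation in counting form: the sum over pairs of colourings will be moved inside
-- the sum over pairs of vertex tuples.
sum₂-swap : ∀ {m′ n′} (F : Vec (Fin k) m → Vec (Fin k) n → Vec (Fin l) m′ → Vec (Fin l) n′ → ℕ) →
  sum₂ k m n (λ x y → sum₂ l m′ n′ (F x y)) ≡ sum₂ l m′ n′ (λ x′ y′ → sum₂ k m n (λ x y → F x y x′ y′))
sum₂-swap {k} {m} {n} {l} {m′} {n′} F = begin
  sumVec k m (λ x → sumVec k n (λ y → sumVec l m′ (λ x′ → sumVec l n′ (λ y′ → F x y x′ y′))))
    ≡⟨ sumVec-cong (λ x → sumVec-swap (λ y x′ → sumVec l n′ (F x y x′))) ⟩
  sumVec k m (λ x → sumVec l m′ (λ x′ → sumVec k n (λ y → sumVec l n′ (λ y′ → F x y x′ y′))))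
    ≡⟨ sumVec-swap {k} {m} {l} {m′} _ ⟩
  sumVec l m′ (λ x′ → sumVec k m (λ x → sumVec k n (λ y → sumVec l n′ (λ y′ → F x y x′ y′))))
    ≡⟨ sumVec-cong (λ x′ → sumVec-cong (λ x → sumVec-swap (λ y → F x y x′))) ⟩
  sumVec l m′ (λ x′ → sumVec k m (λ x → sumVec l n′ (λ y′ → sumVec k n (λ y → F x y x′ y′))))
    ≡⟨ sumVec-cong (λ x′ → sumVec-swap (λ x y′ → sumVec k n (λ y → F x y x′ y′))) ⟩
  sumVec l m′ (λ x′ → sumVec l n′ (λ y′ → sumVec k m (λ x → sumVec k n (λ y → F x y x′ y′))))
    ∎
  where open ≡-Reasoning

sum₂-≤⇒∃ : (F G : Vec (Fin (suc k)) m → Vec (Fin (suc k)) n → ℕ) →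
  sum₂ (suc k) m n F ≤ sum₂ (suc k) m n G → ∃[ x ] ∃[ y ] F x y ≤ G x y
sum₂-≤⇒∃ F G ΣF≤ΣG =
  let x , p = sumVec-≤⇒∃ (λ x → sumVec _ _ (F x)) (λ x → sumVec _ _ (G x)) ΣF≤ΣG
      y , q = sumVec-≤⇒∃ (F x) (G x) p
  in x , y , q

-- Independence of the values of a random function at distinct points

-- Overwriting position `i` forgets only the old value there, so every function arises as
-- `f [ i ]≔ a` from exactly `k` pairs of `f` and `a`.
resample : (F : Vec (Fin k) n → ℕ) (i : Fin n) →
  k * sumVec k n F ≡ sumVec k n (λ f → sumFin k (λ a → F (f [ i ]≔ a)))
resample {k} {suc n} F zero = begin
  k * sumFin k (λ a → sumVec k n (λ f → F (a ∷ f)))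
    ≡⟨ cong (k *_) (sumFin-sumVec-swap (λ a f → F (a ∷ f))) ⟩
  k * sumVec k n (λ f → sumFin k (λ a → F (a ∷ f)))
    ≡⟨ sumFin-const k _ ⟨
  sumFin k (λ _ → sumVec k n (λ f → sumFin k (λ a → F (a ∷ f))))
    ∎
  where open ≡-Reasoning
resample {k} {suc n} F (suc i) = begin
  k * sumFin k (λ b → sumVec k n (λ f → F (b ∷ f)))
    ≡⟨ sumFin-*ˡ {k} k _ ⟨
  sumFin k (λ b → k * sumVec k n (λ f → F (b ∷ f)))
    ≡⟨ sumFin-cong (λ b → resample (λ f → F (b ∷ f)) i) ⟩
  sumFin k (λ b → sumVec k n (λ f → sumFin k (λ a → F (b ∷ (f [ i ]≔ a)))))
    ∎
  where open ≡-Reasoning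

map-lookup-update : ∀ {i : Fin n} {is : Vec (Fin n) m} → All (i ≢_) is →
  ∀ (f : Vec (Fin k) n) a → map (lookup (f [ i ]≔ a)) is ≡ map (lookup f) is
map-lookup-update []             f a = refl
map-lookup-update (i≢j ∷ i∉is) f a =
  cong₂ _∷_ (lookup∘update′ (λ j≡i → i≢j (sym j≡i)) f a) (map-lookup-update i∉is f a)

-- Resampling at the first point turns its value into a free summation variable; the other points
-- differ from it, so their values are untouched and induction applies. Probabilities are
-- cross-multiplied to stay in ℕ.
equidistribution : {is : Vec (Fin n) m} → Unique is → (Φ : Vec (Fin k) m → ℕ) →
  k ^ m * sumVec k n (λ f → Φ (map (lookup f) is)) ≡ k ^ n * sumVec k m Φ
equidistribution {n} {k = k} [] Φ = begin
  1 * sumVec k n (λ _ → Φ []) ≡⟨ *-identityˡ _ ⟩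
  sumVec k n (λ _ → Φ [])     ≡⟨ sumVec-const k n (Φ []) ⟩
  k ^ n * Φ []                ∎
  where open ≡-Reasoning
equidistribution {n} {suc m} {k} {i ∷ is} (i∉is ∷ is!) Φ = begin
  k * k ^ m * sumVec k n (λ f → Φ (lookup f i ∷ map (lookup f) is))
    ≡⟨ (rearrange k (k ^ m) _) ⟩
  k ^ m * (k * sumVec k n (λ f → Φ (lookup f i ∷ map (lookup f) is)))
    ≡⟨ cong (k ^ m *_) (resample _ i) ⟩
  k ^ m * sumVec k n (λ f → sumFin k (λ a → Φ (lookup (f [ i ]≔ a) i ∷ map (lookup (f [ i ]≔ a)) is)))
    ≡⟨ cong (k ^ m *_) (sumVec-cong (λ f → sumFin-cong (λ a → cong Φ
         (cong₂ _∷_ (lookup∘update i f a) (map-lookup-update i∉is f a))))) ⟩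
  k ^ m * sumVec k n (λ f → sumFin k (λ a → Φ (a ∷ map (lookup f) is)))
    ≡⟨ cong (k ^ m *_) (sumFin-sumVec-swap {k} {k} {n} _) ⟨
  k ^ m * sumFin k (λ a → sumVec k n (λ f → Φ (a ∷ map (lookup f) is)))
    ≡⟨ sumFin-*ˡ {k} (k ^ m) _ ⟨
  sumFin k (λ a → k ^ m * sumVec k n (λ f → Φ (a ∷ map (lookup f) is)))
    ≡⟨ sumFin-cong (λ a → equidistribution is! (λ x → Φ (a ∷ x))) ⟩
  sumFin k (λ a → k ^ n * sumVec k m (λ x → Φ (a ∷ x)))
    ≡⟨ sumFin-*ˡ {k} (k ^ n) _ ⟩
  k ^ n * sumVec k (suc m) Φ
    ∎
  where
  open ≡-Reasoning
  rearrange : ∀ a b c → a * b * c ≡ b * (a * c)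
  rearrange = solve-∀

equidistribution₂ : {is : Vec (Fin N) m} {js : Vec (Fin N) n} → Unique is → Unique js →
  (Φ : Vec (Fin k) m → Vec (Fin k) n → ℕ) →
  k ^ m * k ^ n * sum₂ k N N (λ f g → Φ (map (lookup f) is) (map (lookup g) js))
    ≡ k ^ N * k ^ N * sum₂ k m n Φ
equidistribution₂ {N} {m} {n} {k} {is} {js} is! js! Φ = begin
  k ^ m * k ^ n * sumVec k N (λ f → sumVec k N (λ g → Φ (map (lookup f) is) (map (lookup g) js)))
    ≡⟨ *-assoc (k ^ m) (k ^ n) _ ⟩
  k ^ m * (k ^ n * sumVec k N (λ f → sumVec k N (λ g → Φ (map (lookup f) is) (map (lookup g) js))))
    ≡⟨ cong (k ^ m *_) (sumVec-*ˡ {k} {N} (k ^ n) _) ⟨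
  k ^ m * sumVec k N (λ f → k ^ n * sumVec k N (λ g → Φ (map (lookup f) is) (map (lookup g) js)))
    ≡⟨ cong (k ^ m *_) (sumVec-cong (λ f → equidistribution js! (Φ (map (lookup f) is)))) ⟩
  k ^ m * sumVec k N (λ f → k ^ N * sumVec k n (Φ (map (lookup f) is)))
    ≡⟨ equidistribution is! (λ x → k ^ N * sumVec k n (Φ x)) ⟩
  k ^ N * sumVec k m (λ x → k ^ N * sumVec k n (Φ x))
    ≡⟨ cong (k ^ N *_) (sumVec-*ˡ {k} {m} (k ^ N) _) ⟩
  k ^ N * (k ^ N * sum₂ k m n Φ)
    ≡⟨ *-assoc (k ^ N) (k ^ N) _ ⟨
  k ^ N * k ^ N * sum₂ k m n Φ
    ∎
  where open ≡-Reasoning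

-- Counting copies of small bipartite graphs

Template : ℕ → ℕ → Set
Template m n = List (Fin m × Fin n)

-- A product of 0/1 indicators, one per template edge, so that it is multiplicative under
-- intersection of graphs.
weight : (Fin m → Fin n → Bool) → Template m n → ℕ
weight R []            = 1
weight R ((i , j) ∷ T) = ι (R i j) * weight R T

weight-cong : {R S : Fin m → Fin n → Bool} → (∀ i j → R i j ≡ S i j) →
  ∀ T → weight R T ≡ weight S T
weight-cong R≡S []            = refl
weight-cong R≡S ((i , j) ∷ T) = cong₂ _*_ (cong ι (R≡S i j)) (weight-cong R≡S T)

weight-∧ : (R S : Fin m → Fin n → Bool) →
  ∀ T → weight (λ i j → R i j ∧ S i j) T ≡ weight R T * weight S T
weight-∧ R S []            = refl
weight-∧ R S ((i , j) ∷ T) = trans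
  (cong₂ _*_ (ι-∧ (R i j) (S i j)) (weight-∧ R S T))
  (interchange (ι (R i j)) (ι (S i j)) (weight R T) (weight S T))
  where
  interchange : ∀ a b c d → a * b * (c * d) ≡ a * c * (b * d)
  interchange = solve-∀

weight≤1 : (R : Fin m → Fin n → Bool) → ∀ T → weight R T ≤ 1
weight≤1 R []            = ≤-refl
weight≤1 R ((i , j) ∷ T) = *-mono-≤ (ι≤1 (R i j)) (weight≤1 R T)

unique? : (x : Vec (Fin N) m) → Dec (Unique x)
unique? = allPairs? (λ i j → ¬? (i ≟ j))

uniq : Vec (Fin N) m → ℕ
uniq x = ι (does (unique? x))

at : BipGraph N N → Vec (Fin N) m → Vec (Fin N) n → Fin m → Fin n → Bool
at G vs ws i j = G (lookup vs i) (lookup ws j)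

-- Indicator of a labelled injective copy of `T`. Tuples with repeated vertices stay in the range of
-- summation and contribute zero.
embedding : Template m n → BipGraph N N → Vec (Fin N) m → Vec (Fin N) n → ℕ
embedding T G vs ws = uniq vs * uniq ws * weight (at G vs ws) T

embeddings : Template m n → BipGraph N N → ℕ
embeddings {m} {n} {N} T G = sum₂ N m n (embedding T G)

embeddings≤ : (T : Template m n) (G : BipGraph N N) → embeddings T G ≤ N ^ m * N ^ n
embeddings≤ {m} {n} {N} T G = begin
  embeddings T G           ≤⟨ sum₂-mono (λ vs ws → *-mono-≤
                                (*-mono-≤ (ι≤1 (does (unique? vs))) (ι≤1 (does (unique? ws))))
                                (weight≤1 (at G vs ws) T)) ⟩
  sum₂ N m n (λ _ _ → 1)   ≡⟨ sum₂-const N m n 1 ⟩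
  N ^ m * N ^ n * 1        ≡⟨ *-identityʳ _ ⟩
  N ^ m * N ^ n            ∎
  where open ≤-Reasoning

-- Random three-colourings and expected numbers of copies

proper : Fin 3 → Fin 3 → Bool
proper a b = not (does (a ≟ b))

colourGraph : Vec (Fin 3) N → Vec (Fin 3) N → BipGraph N N
colourGraph f g v w = proper (lookup f v) (lookup g w)

infixr 7 _∩_
_∩_ : BipGraph m n → BipGraph m n → BipGraph m n
(G ∩ H) v w = G v w ∧ H v w

-- Counts homomorphisms, respecting the two sides, from the template to `K₃,₃` minus a perfect
-- matching. Divided by `3 ^ (m + n)`, this is the probability that a fixed copy survives a random
-- colouring.
homs : Template m n → ℕ
homs {m} {n} T = sum₂ 3 m n (λ x y → weight (λ i j → proper (lookup x i) (lookup y j)) T)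

colourings : {vs : Vec (Fin N) m} {ws : Vec (Fin N) n} → Unique vs → Unique ws → (T : Template m n) →
  3 ^ m * 3 ^ n * sum₂ 3 N N (λ f g → weight (at (colourGraph f g) vs ws) T) ≡ 3 ^ N * 3 ^ N * homs T
colourings {N} {m} {n} {vs} {ws} vs! ws! T = trans
  (cong (3 ^ m * 3 ^ n *_) (sum₂-cong (λ f g → weight-cong (λ i j →
    sym (cong₂ proper (lookup-map i (lookup f) vs) (lookup-map j (lookup g) ws))) T)))
  (equidistribution₂ vs! ws! (λ x y → weight (λ i j → proper (lookup x i) (lookup y j)) T))

colourings-embedding : (T : Template m n) (G : BipGraph N N) (vs : Vec (Fin N) m) (ws : Vec (Fin N) n) →
  3 ^ m * 3 ^ n * sum₂ 3 N N (λ f g → embedding T (G ∩ colourGraph f g) vs ws)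
    ≡ 3 ^ N * 3 ^ N * homs T * embedding T G vs ws
colourings-embedding {m} {n} {N} T G vs ws = begin
  c * sum₂ 3 N N (λ f g → embedding T (G ∩ colourGraph f g) vs ws)
    ≡⟨ cong (c *_) (sum₂-cong (λ f g → trans
         (cong (uniq vs * uniq ws *_) (weight-∧ (at G vs ws) (at (colourGraph f g) vs ws) T))
         (sym (*-assoc (uniq vs * uniq ws) _ _)))) ⟩
  c * sum₂ 3 N N (λ f g → embedding T G vs ws * weight (at (colourGraph f g) vs ws) T)
    ≡⟨ cong (c *_) (sum₂-*ˡ {3} {N} {N} (embedding T G vs ws) _) ⟩
  c * (embedding T G vs ws * S)
    ≡⟨ lemma ⟩
  3 ^ N * 3 ^ N * homs T * embedding T G vs ws
    ∎
  where
  open ≡-Reasoning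
  c = 3 ^ m * 3 ^ n
  S = sum₂ 3 N N (λ f g → weight (at (colourGraph f g) vs ws) T)
  rearrange : ∀ a b c → a * (b * c) ≡ a * c * b
  rearrange = solve-∀
  lemma : c * (embedding T G vs ws * S) ≡ 3 ^ N * 3 ^ N * homs T * embedding T G vs ws
  -- A repeated vertex makes both sides vanish, so equidistribution is invoked only for distinct
  -- vertices.
  lemma with unique? vs | unique? ws
  ... | no  _   | _       = trans (*-zeroʳ c) (sym (*-zeroʳ (3 ^ N * 3 ^ N * homs T)))
  ... | yes _   | no  _   = trans (*-zeroʳ c) (sym (*-zeroʳ (3 ^ N * 3 ^ N * homs T)))
  ... | yes vs! | yes ws! = trans (rearrange c _ S) (cong (λ x → x * (1 * weight (at G vs ws) T)) (colourings vs! ws! T))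

average : (T : Template m n) (G : BipGraph N N) →
  3 ^ m * 3 ^ n * sum₂ 3 N N (λ f g → embeddings T (G ∩ colourGraph f g))
    ≡ 3 ^ N * 3 ^ N * homs T * embeddings T G
average {m} {n} {N} T G = begin
  c * sum₂ 3 N N (λ f g → sum₂ N m n (embedding T (G ∩ colourGraph f g)))
    ≡⟨ cong (c *_) (sum₂-swap {3} {N} {N} {N} {m} {n} _) ⟩
  c * sum₂ N m n (λ vs ws → sum₂ 3 N N (λ f g → embedding T (G ∩ colourGraph f g) vs ws))
    ≡⟨ sum₂-*ˡ {N} {m} {n} c _ ⟨
  sum₂ N m n (λ vs ws → c * sum₂ 3 N N (λ f g → embedding T (G ∩ colourGraph f g) vs ws))
    ≡⟨ sum₂-cong (colourings-embedding T G) ⟩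
  sum₂ N m n (λ vs ws → 3 ^ N * 3 ^ N * homs T * embedding T G vs ws)
    ≡⟨ sum₂-*ˡ {N} {m} {n} (3 ^ N * 3 ^ N * homs T) _ ⟩
  3 ^ N * 3 ^ N * homs T * embeddings T G
    ∎
  where
  open ≡-Reasoning
  c = 3 ^ m * 3 ^ n

-- The three templates and their survival probabilities

edge : Template 1 1
edge = (0F , 0F) ∷ []

square : Template 2 2
square = (0F , 0F) ∷ (0F , 1F) ∷ (1F , 0F) ∷ (1F , 1F) ∷ []

-- The pendant right vertex has index `0F`, so attaching it to a square on `ws` gives the tuple
-- `w ∷ ws`. It hangs on left vertex `0F`, the one whose edges pruning deletes. The other entries
-- follow the order of `square`.
squareWithPendant : Template 2 3
squareWithPendant = (0F , 0F) ∷ (0F , 1F) ∷ (0F , 2F) ∷ (1F , 1F) ∷ (1F , 2F) ∷ []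

numEdges≡embeddings : (G : BipGraph N N) → numEdges G ≡ embeddings edge G
numEdges≡embeddings G = sumFin-cong (λ v → sumFin-cong (λ w → sym (simplify (ι (G v w)))))
  where
  simplify : ∀ x → 1 * 1 * (x * 1) ≡ x
  simplify = solve-∀

colourCount : ℕ → ℕ
colourCount N = 3 ^ N * 3 ^ N

-- The three survival probabilities arise as 6/9, 18/81 and 36/243. This lemma and `average-cancel`
-- bring them to the common denominator 27 by expanding or cancelling a factor `c`.
average-scale : ∀ a b c S Z e → a * S ≡ Z * b * e → c * a * S ≡ c * b * (Z * e)
average-scale a b c S Z e eq = begin
  c * a * S       ≡⟨ *-assoc c a S ⟩
  c * (a * S)     ≡⟨ cong (c *_) eq ⟩
  c * (Z * b * e) ≡⟨ rearrange c Z b e ⟩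
  c * b * (Z * e) ∎
  where
  open ≡-Reasoning
  rearrange : ∀ x y z t → x * (y * z * t) ≡ x * z * (y * t)
  rearrange = solve-∀

average-cancel : ∀ a b c S Z e .{{_ : NonZero c}} → c * a * S ≡ Z * (c * b) * e → a * S ≡ b * (Z * e)
average-cancel a b c S Z e eq = *-cancelˡ-≡ _ _ c (begin
  c * (a * S)       ≡⟨ *-assoc c a S ⟨
  c * a * S         ≡⟨ eq ⟩
  Z * (c * b) * e   ≡⟨ rearrange Z c b e ⟩
  c * (b * (Z * e)) ∎)
  where
  open ≡-Reasoning
  rearrange : ∀ x y z t → x * (y * z) * t ≡ y * (z * (x * t))
  rearrange = solve-∀

average-edges : (G : BipGraph N N) →
  27 * sum₂ 3 N N (λ f g → numEdges (G ∩ colourGraph f g)) ≡ 18 * (colourCount N * numEdges G)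
average-edges {N} G = average-scale 9 6 3 (sum₂ 3 N N (λ f g → numEdges (G ∩ colourGraph f g))) (colourCount N) (numEdges G) (begin
  9 * sum₂ 3 N N (λ f g → numEdges (G ∩ colourGraph f g))
    ≡⟨ cong (λ S → 9 * S) (sum₂-cong (λ f g → numEdges≡embeddings (G ∩ colourGraph f g))) ⟩
  9 * sum₂ 3 N N (λ f g → embeddings edge (G ∩ colourGraph f g))
    ≡⟨ average edge G ⟩
  colourCount N * 6 * embeddings edge G
    ≡⟨ cong (λ e → colourCount N * 6 * e) (numEdges≡embeddings G) ⟨
  colourCount N * 6 * numEdges G
    ∎)
  where open ≡-Reasoning

average-squares : (G : BipGraph N N) →
  27 * sum₂ 3 N N (λ f g → embeddings square (G ∩ colourGraph f g))
    ≡ 6 * (colourCount N * embeddings square G)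
average-squares {N} G =
  average-cancel 27 6 3 (sum₂ 3 N N (λ f g → embeddings square (G ∩ colourGraph f g)))
    (colourCount N) (embeddings square G) (average square G)

average-pendants : (G : BipGraph N N) →
  27 * sum₂ 3 N N (λ f g → embeddings squareWithPendant (G ∩ colourGraph f g))
    ≡ 4 * (colourCount N * embeddings squareWithPendant G)
average-pendants {N} G =
  average-cancel 27 4 9 (sum₂ 3 N N (λ f g → embeddings squareWithPendant (G ∩ colourGraph f g)))
    (colourCount N) (embeddings squareWithPendant G) (average squareWithPendant G)

-- With E, P, K the numbers of edges, pendant squares and squares, this says that αE - βP - γK for
-- `G′` is at least the value obtained from `G` with survival rates `a/b`, `c/b`, `d/b`.
-- Denominators and subtractions are cleared.
Improvement : (a b c d α β γ : ℕ) → BipGraph N N → BipGraph N N → Set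
Improvement a b c d α β γ G G′ =
  α * (a * numEdges G) + (β * (b * embeddings squareWithPendant G′) + γ * (b * embeddings square G′))
    ≤ α * (b * numEdges G′) + (β * (c * embeddings squareWithPendant G) + γ * (d * embeddings square G))

-- By the three averages both sides have the same total over all pairs of colourings, so some pair
-- satisfies the inequality.
goodColouring : (G : BipGraph N N) (α β γ : ℕ) →
  ∃[ f ] ∃[ g ] Improvement 18 27 4 6 α β γ G (G ∩ colourGraph f g)
goodColouring {N} G α β γ = sum₂-≤⇒∃
  (λ f g → c + (β * (27 * P f g) + γ * (27 * K f g))) (λ f g → α * (27 * E f g) + c′) (≤-reflexive (begin
  sum₂ 3 N N (λ f g → c + (β * (27 * P f g) + γ * (27 * K f g)))
    ≡⟨ sum₂-+ {3} {N} {N} (λ _ _ → c) _ ⟩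
  sum₂ 3 N N (λ _ _ → c) + sum₂ 3 N N (λ f g → β * (27 * P f g) + γ * (27 * K f g))
    ≡⟨ cong₂ _+_ (sum₂-const 3 N N c) (sum₂-+ {3} {N} {N} (λ f g → β * (27 * P f g)) _) ⟩
  Z * c + (sum₂ 3 N N (λ f g → β * (27 * P f g)) + sum₂ 3 N N (λ f g → γ * (27 * K f g)))
    ≡⟨ cong (Z * c +_) (cong₂ _+_ (scaled β P (average-pendants G)) (scaled γ K (average-squares G))) ⟩
  Z * c + (β * (4 * (Z * embeddings squareWithPendant G)) + γ * (6 * (Z * embeddings square G)))
    ≡⟨ rearrange Z α β γ 18 4 6 (numEdges G) (embeddings squareWithPendant G) (embeddings square G) ⟩
  α * (18 * (Z * numEdges G)) + Z * c′
    ≡⟨ cong₂ _+_ (scaled α E (average-edges G)) (sum₂-const 3 N N c′) ⟨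
  sum₂ 3 N N (λ f g → α * (27 * E f g)) + sum₂ 3 N N (λ _ _ → c′)
    ≡⟨ sum₂-+ {3} {N} {N} (λ f g → α * (27 * E f g)) _ ⟨
  sum₂ 3 N N (λ f g → α * (27 * E f g) + c′)
    ∎))
  where
  open ≡-Reasoning
  Z = colourCount N
  E P K : Vec (Fin 3) N → Vec (Fin 3) N → ℕ
  E f g = numEdges (G ∩ colourGraph f g)
  P f g = embeddings squareWithPendant (G ∩ colourGraph f g)
  K f g = embeddings square (G ∩ colourGraph f g)
  c  = α * (18 * numEdges G)
  c′ = β * (4 * embeddings squareWithPendant G) + γ * (6 * embeddings square G)
  scaled : ∀ δ (X : Vec (Fin 3) N → Vec (Fin 3) N → ℕ) {y} →
    27 * sum₂ 3 N N X ≡ y → sum₂ 3 N N (λ f g → δ * (27 * X f g)) ≡ δ * y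
  scaled δ X eq = trans (sum₂-*ˡ {3} {N} {N} δ _)
    (cong (δ *_) (trans (sum₂-*ˡ {3} {N} {N} 27 X) eq))
  rearrange : ∀ z a b c x y t e p k →
    z * (a * (x * e)) + (b * (y * (z * p)) + c * (t * (z * k)))
      ≡ a * (x * (z * e)) + z * (b * (y * p) + c * (t * k))
  rearrange = solve-∀

-- Conjunctive normal forms

HasCNF-cong : {G H : BipGraph m n} → (∀ v w → G v w ≡ H v w) → HasCNF H k → HasCNF G k
HasCNF-cong G≡H (A , B , isCNF) = A , B , λ v w → trans (G≡H v w) (isCNF v w)

HasCNF-CL : {G : BipGraph m n} (A : SubsetOf m) (B : SubsetOf n) →
  HasCNF G k → HasCNF (CL A B ∩ G) (suc k)
HasCNF-CL {m} {n} {k} A B (As , Bs , isCNF) =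
  As′ , Bs′ , λ v w → cong ((A v ∨ B w) ∧_) (isCNF v w)
  where
  As′ : Fin (suc k) → SubsetOf m
  As′ zero    = A
  As′ (suc i) = As i
  Bs′ : Fin (suc k) → SubsetOf n
  Bs′ zero    = B
  Bs′ (suc i) = Bs i

avoid : Vec (Fin 3) N → Fin 3 → SubsetOf N
avoid f a v = proper (lookup f v) a

-- Two colours differ exactly when, for each of the three colours, at least one of them avoids it;
-- each colour gives one clause.
HasCNF-colouring : {G : BipGraph N N} (f g : Vec (Fin 3) N) →
  HasCNF G k → HasCNF (G ∩ colourGraph f g) (3 + k)
HasCNF-colouring {G = G} f g cnf = HasCNF-cong
  (λ v w → trans (∧-comm (G v w) _) (clauses (lookup f v) (lookup g w) (G v w)))
  (HasCNF-CL (avoid f 0F) (avoid g 0F)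
    (HasCNF-CL (avoid f 1F) (avoid g 1F)
      (HasCNF-CL (avoid f 2F) (avoid g 2F) cnf)))
  where
  clauses : ∀ a b x → proper a b ∧ x ≡
    (proper a 0F ∨ proper b 0F) ∧ (proper a 1F ∨ proper b 1F) ∧ (proper a 2F ∨ proper b 2F) ∧ x
  clauses 0F 0F x = refl
  clauses 0F 1F x = refl
  clauses 0F 2F x = refl
  clauses 1F 0F x = refl
  clauses 1F 1F x = refl
  clauses 1F 2F x = refl
  clauses 2F 0F x = refl
  clauses 2F 1F x = refl
  clauses 2F 2F x = refl

-- Iterating the colouring step

complete : BipGraph N N
complete v w = true

numEdges-complete : ∀ N → numEdges (complete {N}) ≡ N * N
numEdges-complete N = trans
  (sumFin-cong {N} (λ _ → trans (sumFin-const N 1) (*-identityʳ N)))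
  (sumFin-const N N)

-- The accumulated form of `Improvement` relative to the complete graph: `A/B`, `C/B`, `D/B` are the
-- survival rates after all rounds, and the powers of `N` are trivial bounds for the initial numbers
-- of copies.
Potential : (A B C D α β γ : ℕ) → BipGraph N N → Set
Potential {N} A B C D α β γ G =
  A * (α * (N * N)) + B * (β * embeddings squareWithPendant G + γ * embeddings square G)
    ≤ B * (α * numEdges G) + (C * (β * (N ^ 2 * N ^ 3)) + D * (γ * (N ^ 2 * N ^ 2)))

-- The earlier bound is taken with weights already multiplied by the rates of the new round. The
-- counts in `G` then occur on opposite sides of the two inequalities and cancel when these are
-- added.
potential-step : ∀ A B C D a b c d α β γ (G G′ : BipGraph N N) →
  Potential A B C D (α * a) (β * c) (γ * d) G → Improvement a b c d α β γ G G′ →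
  Potential (a * A) (b * B) (c * C) (d * D) α β γ G′
potential-step {N} A B C D a b c d α β γ G G′ bound step =
  subst₂ _≤_
    (cong₂ _+_ (pull A α a e₀) (pull₂ B β γ b p′ q′))
    (cong₂ _+_ (pull′ B α b e′) (cong₂ _+_ (pull C β c p₀) (pull D γ d q₀)))
    (cancel-middle (A * (α * a * e₀)) (B * (β * c * p + γ * d * q)) (B * (α * a * e))
      (C * (β * c * p₀) + D * (γ * d * q₀)) (B * (β * (b * p′) + γ * (b * q′))) (B * (α * (b * e′))) bound
      (subst₂ _≤_
        (trans (*-distribˡ-+ B (α * (a * e)) _)
          (cong (λ x → B * x + B * (β * (b * p′) + γ * (b * q′))) (sym (*-assoc α a e))))
        (trans (*-distribˡ-+ B (α * (b * e′)) _)
          (cong₂ (λ x y → B * (α * (b * e′)) + B * (x + y))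
            (sym (*-assoc β c p)) (sym (*-assoc γ d q))))
        (*-monoʳ-≤ B step)))
  where
  e₀ = N * N
  p₀ = N ^ 2 * N ^ 3
  q₀ = N ^ 2 * N ^ 2
  e  = numEdges G
  p  = embeddings squareWithPendant G
  q  = embeddings square G
  e′ = numEdges G′
  p′ = embeddings squareWithPendant G′
  q′ = embeddings square G′
  pull : ∀ x y z t → x * (y * z * t) ≡ z * x * (y * t)
  pull = solve-∀
  pull′ : ∀ x y z t → x * (y * (z * t)) ≡ z * x * (y * t)
  pull′ = solve-∀
  pull₂ : ∀ x y y′ z t t′ → x * (y * (z * t) + y′ * (z * t′)) ≡ z * x * (y * t + y′ * t′)
  pull₂ = solve-∀
  cancel-middle : ∀ x y u v s w → x + y ≤ u + v → u + s ≤ w + y → x + s ≤ w + v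
  cancel-middle x y u v s w p q = +-cancelʳ-≤ (y + u) _ _
    (subst₂ _≤_ (shuffle x y u s) (trans (+-comm (u + v) _) (shuffle w y u v)) (+-mono-≤ p q))
    where
    shuffle : ∀ x y u s → (x + y) + (u + s) ≡ (x + s) + (y + u)
    shuffle = solve-∀

-- The weights stay universally quantified because earlier colourings must be chosen for weights
-- that anticipate the later rounds; the recursive call scales them accordingly.
colouredGraph : ∀ N r α β γ →
  Σ[ G ∈ BipGraph N N ] (HasCNF G (r * 3) × Potential (18 ^ r) (27 ^ r) (4 ^ r) (6 ^ r) α β γ G)
-- The complete graph is the intersection of no clauses.
colouredGraph N zero α β γ = complete , ((λ ()) , (λ ()) , λ v w → refl) , (begin
  1 * (α * (N * N)) + 1 * (β * embeddings squareWithPendant G + γ * embeddings square G)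
    ≤⟨ +-mono-≤ (≤-reflexive (cong (λ e → 1 * (α * e)) (sym (numEdges-complete N))))
         (*-monoʳ-≤ 1 (+-mono-≤ (*-monoʳ-≤ β (embeddings≤ squareWithPendant G))
                                (*-monoʳ-≤ γ (embeddings≤ square G)))) ⟩
  1 * (α * numEdges G) + 1 * (β * (N ^ 2 * N ^ 3) + γ * (N ^ 2 * N ^ 2))
    ≡⟨ cong (1 * (α * numEdges G) +_) (*-distribˡ-+ 1 (β * (N ^ 2 * N ^ 3)) _) ⟩
  1 * (α * numEdges G) + (1 * (β * (N ^ 2 * N ^ 3)) + 1 * (γ * (N ^ 2 * N ^ 2)))
    ∎)
  where
  open ≤-Reasoning
  G : BipGraph N N
  G = complete
colouredGraph N (suc r) α β γ =
  let G , cnf , bound = colouredGraph N r (α * 18) (β * 4) (γ * 6)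
      f , g , step    = goodColouring G α β γ
  in G ∩ colourGraph f g , HasCNF-colouring f g cnf ,
     potential-step (18 ^ r) (27 ^ r) (4 ^ r) (6 ^ r) 18 27 4 6 α β γ G (G ∩ colourGraph f g) bound step

-- Deleting the left vertices that lie on a square

uniq-∷ : {w : Fin N} {ws : Vec (Fin N) n} → All (w ≢_) ws → uniq (w ∷ ws) ≡ uniq ws
uniq-∷ {w = w} {ws} w∉ws = cong ι (does-⇔ (mk⇔ AllPairs.tail (w∉ws ∷_)) (unique? (w ∷ ws)) (unique? ws))

-- Fixes left vertex `0F` of the labelled square, so that summing over `v` is definitionally
-- `embeddings square G`.
squaresAt : BipGraph N N → Fin N → ℕ
squaresAt {N} G v = sumFin N (λ v₂ → sumVec N 2 (λ ws → embedding square G (v ∷ v₂ ∷ []) ws))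

squareFree : BipGraph N N → SubsetOf N
squareFree G v = squaresAt G v ≡ᵇ 0

-- With an empty right set the clause graph consists of all pairs whose left vertex is in
-- `squareFree G`, so one clause isolates every other left vertex.
prune : BipGraph N N → BipGraph N N
prune G = CL (squareFree G) (λ _ → false) ∩ G

-- A square in the pruned graph is also one in `G`, so `squaresAt G v₁` is positive; but the
-- surviving edge at `v₁` forces this count to be zero.
prune-K22Free : (G : BipGraph N N) → K22Free (prune G)
prune-K22Free {N} G v₁ v₂ w₁ w₂ v₁≢v₂ w₁≢w₂ (e₁₁ , e₁₂ , e₂₁ , e₂₂) = <⇒≱ 0<squares (≤-reflexive squares≡0)
  where
  vs ws : Vec (Fin N) 2
  vs = v₁ ∷ v₂ ∷ []
  ws = w₁ ∷ w₂ ∷ []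

  kept : ∀ {v w} → prune G v w ≡ true → G v w ≡ true
  kept {v} p with squareFree G v
  ... | true = p

  squares≡0 : squaresAt G v₁ ≡ 0
  squares≡0 with squaresAt G v₁
  ... | zero  = refl
  ... | suc _ = contradiction e₁₁ λ ()

  uniq≡1 : {i j : Fin N} → i ≢ j → uniq (i ∷ j ∷ []) ≡ 1
  uniq≡1 i≢j = cong ι (dec-true (unique? _) ((i≢j ∷ []) ∷ [] ∷ []))

  square≡1 : embedding square G vs ws ≡ 1
  square≡1 rewrite uniq≡1 v₁≢v₂ | uniq≡1 w₁≢w₂
    | kept e₁₁ | kept e₁₂ | kept e₂₁ | kept e₂₂ = refl

  0<squares : 0 < squaresAt G v₁
  0<squares = begin-strict
    0                                                  <⟨ ≤-reflexive (sym square≡1) ⟩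
    embedding square G vs ws                           ≤⟨ term≤sumVec (embedding square G vs) ws ⟩
    sumVec N 2 (embedding square G vs)                 ≤⟨ term≤sumFin (λ v → sumVec N 2 (embedding square G (v₁ ∷ v ∷ []))) v₂ ⟩
    squaresAt G v₁                                     ∎
    where open ≤-Reasoning

-- An edge is lost only if its left vertex lies on a square, and then the factor `squaresAt G v` is
-- at least one and pays for it.
edge≤prune : (G : BipGraph N N) (v w : Fin N) →
  ι (G v w) ≤ ι (prune G v w) + squaresAt G v * ι (G v w)
edge≤prune G v w with squaresAt G v
... | zero  = m≤m+n _ _
... | suc s = m≤m+n _ _

sumFin-≟ : (j : Fin k) → sumFin k (λ i → ι (does (i ≟ j))) ≡ 1
sumFin-≟ {suc k} zero    = cong suc (trans (sumFin-const k 0) (*-zeroʳ k))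
sumFin-≟ {suc k} (suc j) = sumFin-≟ j

-- An edge at a left vertex of a square either ends outside the square, forming a pendant edge, or
-- ends at one of its two right vertices.
square-edge : (G : BipGraph N N) (v v₂ w w₁ w₂ : Fin N) →
  let s = embedding square G (v ∷ v₂ ∷ []) (w₁ ∷ w₂ ∷ []) in
  s * ι (G v w) ≤ embedding squareWithPendant G (v ∷ v₂ ∷ []) (w ∷ w₁ ∷ w₂ ∷ [])
                    + (s * ι (does (w ≟ w₁)) + s * ι (does (w ≟ w₂)))
square-edge {N} G v v₂ w w₁ w₂ = lemma (w ≟ w₁) (w ≟ w₂)
  where
  open ≤-Reasoning
  vs ws : Vec (Fin N) 2
  vs = v ∷ v₂ ∷ []
  ws = w₁ ∷ w₂ ∷ []
  s p : ℕ
  s = embedding square G vs ws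
  p = embedding squareWithPendant G vs (w ∷ ws)
  rearrange : ∀ a b c d → a * b * c * d ≡ a * b * (d * c)
  rearrange = solve-∀
  lemma : (d₁ : Dec (w ≡ w₁)) (d₂ : Dec (w ≡ w₂)) →
    s * ι (G v w) ≤ p + (s * ι (does d₁) + s * ι (does d₂))
  lemma (yes _) d₂ = begin
    s * ι (G v w)                  ≤⟨ *-monoʳ-≤ s (ι≤1 (G v w)) ⟩
    s * 1                          ≤⟨ m≤m+n (s * 1) (s * ι (does d₂)) ⟩
    s * 1 + s * ι (does d₂)        ≤⟨ m≤n+m _ p ⟩
    p + (s * 1 + s * ι (does d₂))  ∎
  lemma (no _) (yes _) = begin
    s * ι (G v w)                  ≤⟨ *-monoʳ-≤ s (ι≤1 (G v w)) ⟩
    s * 1                          ≤⟨ m≤n+m (s * 1) (s * 0) ⟩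
    s * 0 + s * 1                  ≤⟨ m≤n+m _ p ⟩
    p + (s * 0 + s * 1)            ∎
  lemma (no w≢w₁) (no w≢w₂) = begin
    s * ι (G v w)
      ≡⟨ rearrange (uniq vs) (uniq ws) (weight (at G vs ws) square) (ι (G v w)) ⟩
    uniq vs * uniq ws * (ι (G v w) * weight (at G vs ws) square)
      ≡⟨ cong (λ u → uniq vs * u * (ι (G v w) * weight (at G vs ws) square))
           (uniq-∷ (w≢w₁ ∷ w≢w₂ ∷ [])) ⟨
    p
      ≤⟨ m≤m+n p _ ⟩
    p + (s * 0 + s * 0)
      ∎

square-degree : (G : BipGraph N N) (v v₂ : Fin N) (ws : Vec (Fin N) 2) →
  let s = embedding square G (v ∷ v₂ ∷ []) ws in
  s * sumFin N (λ w → ι (G v w))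
    ≤ sumFin N (λ w → embedding squareWithPendant G (v ∷ v₂ ∷ []) (w ∷ ws)) + (s + s)
square-degree {N} G v v₂ (w₁ ∷ w₂ ∷ []) = begin
  s * sumFin N (λ w → ι (G v w))
    ≡⟨ sumFin-*ˡ {N} s _ ⟨
  sumFin N (λ w → s * ι (G v w))
    ≤⟨ sumFin-mono (λ w → square-edge G v v₂ w w₁ w₂) ⟩
  sumFin N (λ w → p w + (s * ι (does (w ≟ w₁)) + s * ι (does (w ≟ w₂))))
    ≡⟨ sumFin-+ {N} p _ ⟩
  sumFin N p + sumFin N (λ w → s * ι (does (w ≟ w₁)) + s * ι (does (w ≟ w₂)))
    ≡⟨ cong (sumFin N p +_) (sumFin-+ {N} (λ w → s * ι (does (w ≟ w₁))) _) ⟩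
  sumFin N p + (sumFin N (λ w → s * ι (does (w ≟ w₁))) + sumFin N (λ w → s * ι (does (w ≟ w₂))))
    ≡⟨ cong (sumFin N p +_) (cong₂ _+_ (once w₁) (once w₂)) ⟩
  sumFin N p + (s + s)
    ∎
  where
  open ≤-Reasoning
  s = embedding square G (v ∷ v₂ ∷ []) (w₁ ∷ w₂ ∷ [])
  p : Fin N → ℕ
  p w = embedding squareWithPendant G (v ∷ v₂ ∷ []) (w ∷ w₁ ∷ w₂ ∷ [])
  once : ∀ j → sumFin N (λ w → s * ι (does (w ≟ j))) ≡ s
  once j = trans (sumFin-*ˡ {N} s _) (trans (cong (s *_) (sumFin-≟ j)) (*-identityʳ s))

squaresAt-degree : (G : BipGraph N N) (v : Fin N) →
  squaresAt G v * sumFin N (λ w → ι (G v w))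
    ≤ sumFin N (λ v₂ → sumVec N 3 (embedding squareWithPendant G (v ∷ v₂ ∷ [])))
        + (squaresAt G v + squaresAt G v)
squaresAt-degree {N} G v = begin
  squaresAt G v * deg
    ≡⟨ *-comm (squaresAt G v) deg ⟩
  deg * squaresAt G v
    ≡⟨ sumFin-*ˡ {N} deg _ ⟨
  sumFin N (λ v₂ → deg * sumVec N 2 (s v₂))
    ≤⟨ sumFin-mono inner ⟩
  sumFin N (λ v₂ → sumVec N 3 (p v₂) + (sumVec N 2 (s v₂) + sumVec N 2 (s v₂)))
    ≡⟨ sumFin-+ {N} (λ v₂ → sumVec N 3 (p v₂)) _ ⟩
  sumFin N (λ v₂ → sumVec N 3 (p v₂)) + sumFin N (λ v₂ → sumVec N 2 (s v₂) + sumVec N 2 (s v₂))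
    ≡⟨ cong (sumFin N (λ v₂ → sumVec N 3 (p v₂)) +_) (sumFin-+ {N} (λ v₂ → sumVec N 2 (s v₂)) _) ⟩
  sumFin N (λ v₂ → sumVec N 3 (p v₂)) + (squaresAt G v + squaresAt G v)
    ∎
  where
  open ≤-Reasoning
  deg = sumFin N (λ w → ι (G v w))
  s : Fin N → Vec (Fin N) 2 → ℕ
  s v₂ = embedding square G (v ∷ v₂ ∷ [])
  p : Fin N → Vec (Fin N) 3 → ℕ
  p v₂ = embedding squareWithPendant G (v ∷ v₂ ∷ [])
  inner : ∀ v₂ → deg * sumVec N 2 (s v₂) ≤ sumVec N 3 (p v₂) + (sumVec N 2 (s v₂) + sumVec N 2 (s v₂))
  inner v₂ = begin
    deg * sumVec N 2 (s v₂)
      ≡⟨ sumVec-*ˡ {N} {2} deg (s v₂) ⟨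
    sumVec N 2 (λ ws → deg * s v₂ ws)
      ≡⟨ sumVec-cong {N} {2} (λ ws → *-comm deg (s v₂ ws)) ⟩
    sumVec N 2 (λ ws → s v₂ ws * deg)
      ≤⟨ sumVec-mono (square-degree G v v₂) ⟩
    sumVec N 2 (λ ws → sumFin N (λ w → p v₂ (w ∷ ws)) + (s v₂ ws + s v₂ ws))
      ≡⟨ sumVec-+ {N} {2} (λ ws → sumFin N (λ w → p v₂ (w ∷ ws))) (λ ws → s v₂ ws + s v₂ ws) ⟩
    sumVec N 2 (λ ws → sumFin N (λ w → p v₂ (w ∷ ws))) + sumVec N 2 (λ ws → s v₂ ws + s v₂ ws)
      ≡⟨ cong₂ _+_ (sym (sumFin-sumVec-swap {N} {N} {2} (λ w ws → p v₂ (w ∷ ws))))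
           (sumVec-+ {N} {2} (s v₂) (s v₂)) ⟩
    sumVec N 3 (p v₂) + (sumVec N 2 (s v₂) + sumVec N 2 (s v₂))
      ∎

-- Each lost edge is charged to the squares at its left vertex. The resulting pairs are squares with
-- a pendant edge, or one of the two edges of a square at that vertex.
numEdges-prune : (G : BipGraph N N) →
  numEdges G ≤ numEdges (prune G) + (embeddings squareWithPendant G + (embeddings square G + embeddings square G))
numEdges-prune {N} G = begin
  sumFin N (λ v → sumFin N (λ w → ι (G v w)))
    ≤⟨ sumFin-mono (λ v → sumFin-mono (edge≤prune G v)) ⟩
  sumFin N (λ v → sumFin N (λ w → ι (prune G v w) + squaresAt G v * ι (G v w)))
    ≡⟨ sumFin-cong (λ v → trans (sumFin-+ {N} (λ w → ι (prune G v w)) _)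
         (cong (sumFin N (λ w → ι (prune G v w)) +_) (sumFin-*ˡ {N} (squaresAt G v) _))) ⟩
  sumFin N (λ v → sumFin N (λ w → ι (prune G v w)) + squaresAt G v * sumFin N (λ w → ι (G v w)))
    ≤⟨ sumFin-mono (λ v → +-monoʳ-≤ (sumFin N (λ w → ι (prune G v w))) (squaresAt-degree G v)) ⟩
  sumFin N (λ v → sumFin N (λ w → ι (prune G v w)) + (P v + (squaresAt G v + squaresAt G v)))
    ≡⟨ sumFin-+ {N} (λ v → sumFin N (λ w → ι (prune G v w))) _ ⟩
  numEdges (prune G) + sumFin N (λ v → P v + (squaresAt G v + squaresAt G v))
    ≡⟨ cong (numEdges (prune G) +_) (trans (sumFin-+ {N} P _)
         (cong (sumFin N P +_) (sumFin-+ {N} (squaresAt G) (squaresAt G)))) ⟩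
  numEdges (prune G) + (embeddings squareWithPendant G + (embeddings square G + embeddings square G))
    ∎
  where
  open ≤-Reasoning
  P : Fin N → ℕ
  P v = sumFin N (λ v₂ → sumVec N 3 (embedding squareWithPendant G (v ∷ v₂ ∷ [])))

-- Choice of parameters

^-distrib-* : ∀ x y u → (x * y) ^ u ≡ x ^ u * y ^ u
^-distrib-* x y zero    = refl
^-distrib-* x y (suc u) = trans (cong (x * y *_) (^-distrib-* x y u)) (interchange x y (x ^ u) (y ^ u))
  where
  interchange : ∀ a b c d → a * b * (c * d) ≡ a * c * (b * d)
  interchange = solve-∀

^-swap : ∀ x i u → (x ^ i) ^ u ≡ (x ^ u) ^ i
^-swap x i u = trans (^-*-assoc x i u) (trans (cong (x ^_) (*-comm i u)) (sym (^-*-assoc x u i)))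

^-split : ∀ a r y u → (a ^ r * y) ^ u ≡ a ^ (r * u) * y ^ u
^-split a r y u = trans (^-distrib-* (a ^ r) y u) (cong (_* y ^ u) (^-*-assoc a r u))

^-split-* : ∀ a r M i j u → (a ^ r * (M ^ i * M ^ j)) ^ u ≡ a ^ (r * u) * ((M ^ u) ^ i * (M ^ u) ^ j)
^-split-* a r M i j u = trans (^-split a r (M ^ i * M ^ j) u)
  (cong (a ^ (r * u) *_) (trans (^-distrib-* (M ^ i) (M ^ j) u) (cong₂ _*_ (^-swap M i u) (^-swap M j u))))

-- One of the `u` factors absorbs the constant `c`; the others use only `x ≤ y`.
*-^-≤ : ∀ c x y u .{{_ : NonZero c}} → c * x ≤ y → 1 ≤ u → c * x ^ u ≤ y ^ u
*-^-≤ c x y (suc u) cx≤y _ = begin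
  c * (x * x ^ u) ≡⟨ *-assoc c x (x ^ u) ⟨
  c * x * x ^ u   ≤⟨ *-mono-≤ cx≤y (^-monoˡ-≤ u (≤-trans (m≤n*m x c) cx≤y)) ⟩
  y * y ^ u       ∎
  where open ≤-Reasoning

half≤ : ∀ x y s t → x ≤ y + (s + t) → 4 * s ≤ x → 4 * t ≤ x → x ≤ 2 * y
half≤ x y s t x≤ 4s≤x 4t≤x = *-cancelˡ-≤ 2 (+-cancelʳ-≤ (2 * x) (2 * x) (2 * (2 * y)) (begin
  2 * x + 2 * x               ≡⟨ double x ⟩
  4 * x                       ≤⟨ *-monoʳ-≤ 4 x≤ ⟩
  4 * (y + (s + t))           ≡⟨ expand y s t ⟩
  2 * (2 * y) + (4 * s + 4 * t) ≤⟨ +-monoʳ-≤ (2 * (2 * y)) (+-mono-≤ 4s≤x 4t≤x) ⟩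
  2 * (2 * y) + (x + x)       ≡⟨ cong (2 * (2 * y) +_) (twice x) ⟩
  2 * (2 * y) + 2 * x         ∎))
  where
  open ≤-Reasoning
  double : ∀ x → 2 * x + 2 * x ≡ 4 * x
  double = solve-∀
  expand : ∀ y s t → 4 * (y + (s + t)) ≡ 2 * (2 * y) + (4 * s + 4 * t)
  expand = solve-∀
  twice : ∀ x → x + x ≡ 2 * x
  twice = solve-∀

-- The weights 1, 1, 2 are the costs in `numEdges-prune`, so the actual numbers of copies cancel and
-- only their initial bounds remain.
Potential⇒pruned-edges : ∀ A B C D (G : BipGraph N N) → Potential A B C D 1 1 2 G →
  A * (N * N) ≤ B * numEdges (prune G) + (C * (N ^ 2 * N ^ 3) + 2 * (D * (N ^ 2 * N ^ 2)))
Potential⇒pruned-edges {N} A B C D G bound = +-cancelʳ-≤ (B * (P + 2 * K)) _ _ (begin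
  A * (N * N) + B * (P + 2 * K)
    ≡⟨ ones A (N * N) B P (2 * K) ⟩
  A * (1 * (N * N)) + B * (1 * P + 2 * K)
    ≤⟨ bound ⟩
  B * (1 * numEdges G) + S
    ≤⟨ +-monoˡ-≤ S (*-monoʳ-≤ B (*-monoʳ-≤ 1 (numEdges-prune G))) ⟩
  B * (1 * (numEdges (prune G) + (P + (K + K)))) + S
    ≡⟨ rearrange B (numEdges (prune G)) P K C D (N ^ 2 * N ^ 3) (N ^ 2 * N ^ 2) ⟩
  B * numEdges (prune G) + (C * (N ^ 2 * N ^ 3) + 2 * (D * (N ^ 2 * N ^ 2))) + B * (P + 2 * K)
    ∎)
  where
  open ≤-Reasoning
  P = embeddings squareWithPendant G
  K = embeddings square G
  S = C * (1 * (N ^ 2 * N ^ 3)) + D * (2 * (N ^ 2 * N ^ 2))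
  ones : ∀ a x b y z → a * x + b * (y + z) ≡ a * (1 * x) + b * (1 * y + z)
  ones = solve-∀
  rearrange : ∀ b e p k c d x y →
    b * (1 * (e + (p + (k + k)))) + (c * (1 * x) + d * (2 * y)) ≡ b * e + (c * x + 2 * (d * y)) + b * (p + 2 * k)
  rearrange = solve-∀

-- Raising the three inequalities for `M` and `r` to the power `u` gives those for `M ^ u` vertices
-- per side and `r * u` rounds. Each of the two loss terms is then at most a quarter of the main
-- term, and half of it survives.
denseGraph : ∀ r M u → 1 ≤ u →
  4 * (4 ^ r * (M ^ 2 * M ^ 3)) ≤ 18 ^ r * (M * M) →
  8 * (6 ^ r * (M ^ 2 * M ^ 2)) ≤ 18 ^ r * (M * M) →
  27 ^ r * (2 * M) ≤ 18 ^ r * (M * M) →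
  Σ[ G ∈ BipGraph (M ^ u) (M ^ u) ]
    (K22Free G × HasCNF G (suc (r * u * 3)) × 2 ^ u * M ^ u ≤ 2 * numEdges G)
denseGraph r M u 1≤u few-pendants few-squares many-edges =
  let G , cnf , bound = colouredGraph V (r * u) 1 1 2
  in prune G , prune-K22Free G , HasCNF-CL (squareFree G) (λ _ → false) cnf , edges G bound
  where
  V = M ^ u
  E = 18 ^ (r * u) * (V * V)
  S = 4 ^ (r * u) * (V ^ 2 * V ^ 3)
  T = 6 ^ (r * u) * (V ^ 2 * V ^ 2)

  open ≤-Reasoning

  E≡ : (18 ^ r * (M * M)) ^ u ≡ E
  E≡ = trans (^-split 18 r (M * M) u) (cong (18 ^ (r * u) *_) (^-distrib-* M M u))

  4S≤E : 4 * S ≤ E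
  4S≤E = subst₂ _≤_ (cong (4 *_) (^-split-* 4 r M 2 3 u)) E≡ (*-^-≤ 4 _ _ u few-pendants 1≤u)

  8T≤E : 8 * T ≤ E
  8T≤E = subst₂ _≤_ (cong (8 *_) (^-split-* 6 r M 2 2 u)) E≡ (*-^-≤ 8 _ _ u few-squares 1≤u)

  enough : 27 ^ (r * u) * (2 ^ u * V) ≤ E
  enough = subst₂ _≤_
    (trans (^-split 27 r (2 * M) u) (cong (27 ^ (r * u) *_) (^-distrib-* 2 M u))) E≡
    (^-monoˡ-≤ u many-edges)

  edges : ∀ G → Potential (18 ^ (r * u)) (27 ^ (r * u)) (4 ^ (r * u)) (6 ^ (r * u)) 1 1 2 G →
    2 ^ u * V ≤ 2 * numEdges (prune G)
  edges G bound = *-cancelˡ-≤ (27 ^ (r * u)) {{m^n≢0 27 (r * u)}} (begin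
    27 ^ (r * u) * (2 ^ u * V)
      ≤⟨ enough ⟩
    E
      ≤⟨ half≤ E (27 ^ (r * u) * numEdges (prune G)) S (2 * T)
           (Potential⇒pruned-edges (18 ^ (r * u)) (27 ^ (r * u)) (4 ^ (r * u)) (6 ^ (r * u)) G bound)
           4S≤E (≤-trans (≤-reflexive (sym (*-assoc 4 2 T))) 8T≤E) ⟩
    2 * (27 ^ (r * u) * numEdges (prune G))
      ≡⟨ swap 2 (27 ^ (r * u)) (numEdges (prune G)) ⟩
    27 ^ (r * u) * (2 * numEdges (prune G))
      ∎)
    where
    swap : ∀ a b c → a * (b * c) ≡ b * (a * c)
    swap = solve-∀

-- Average degree and number of clauses in terms of `d`

log₂-approx : ∀ d → 1 ≤ d → ∃[ u ] (d ≤ 2 ^ u × 2 ^ u ≤ 2 * d)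
log₂-approx (suc zero)    _ = 0 , ≤-refl , s≤s z≤n
log₂-approx (suc (suc d)) _ with log₂-approx (suc d) (s≤s z≤n)
... | u , d≤2^u , 2^u≤2d with suc (suc d) ≤? 2 ^ u
...   | yes 1+d≤2^u = u , 1+d≤2^u , ≤-trans 2^u≤2d (*-monoʳ-≤ 2 (n≤1+n (suc d)))
...   | no  1+d≰2^u =
  -- In this case `2 ^ u` is exactly `suc d`, so the next power is needed and does not overshoot.
  let 2^u≤d = m<1+n⇒m≤n (≰⇒> 1+d≰2^u)
  in suc u ,
     +-mono-≤ (m^n>0 2 u) (≤-trans d≤2^u (m≤m+n (2 ^ u) 0)) ,
     *-monoʳ-≤ 2 (≤-trans 2^u≤d (n≤1+n (suc d)))

-- M = 2¹² and r = 18 make both M³(2/9)ʳ (pendant copies per edge) and M²/3ʳ (squares per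
-- edge) at most 1/8, while the expected degree M(2/3)ʳ is at least 2.
exponentialDegreeGraph : ∀ u → 1 ≤ u → Σ[ V ∈ ℕ ] Σ[ G ∈ BipGraph V V ]
  (1 ≤ V × K22Free G × HasCNF G (suc (18 * u * 3)) × 2 ^ u * V ≤ 2 * numEdges G)
exponentialDegreeGraph u 1≤u =
  let G , spec = denseGraph 18 4096 u 1≤u (≤ᵇ⇒≤ _ _ _) (≤ᵇ⇒≤ _ _ _) (≤ᵇ⇒≤ _ _ _)
  in 4096 ^ u , G , m^n>0 4096 u , spec

-- The average degree is `2e / (V + V)`, which is at least `x / 2` and hence at least `d / 2`. The
-- bound is then raised to the power `q`, and `d ^ p` is at least one.
average-degree : ∀ V e d x p q .{{_ : NonZero d}} → d ≤ x → x * V ≤ 2 * e →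
  (1 * (V + V)) ^ q * d ^ q ≤ (2 * e * 2) ^ q * d ^ p
average-degree V e d x p q d≤x edges = begin
  (1 * (V + V)) ^ q * d ^ q  ≡⟨ ^-distrib-* (1 * (V + V)) d q ⟨
  (1 * (V + V) * d) ^ q      ≤⟨ ^-monoˡ-≤ q (*-monoʳ-≤ (1 * (V + V)) d≤x) ⟩
  (1 * (V + V) * x) ^ q      ≡⟨ cong (_^ q) (rearrange V x) ⟩
  (x * V * 2) ^ q            ≤⟨ ^-monoˡ-≤ q (*-monoˡ-≤ 2 edges) ⟩
  (2 * e * 2) ^ q            ≤⟨ m≤m*n _ (d ^ p) {{m^n≢0 d p}} ⟩
  (2 * e * 2) ^ q * d ^ p    ∎
  where
  open ≤-Reasoning
  rearrange : ∀ v x → 1 * (v + v) * x ≡ x * v * 2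
  rearrange = solve-∀

-- There are 1 + 54u clauses, at most 55u, and `2 ^ u ≤ 2 * d ≤ d ^ 2` doubles the exponent 55 to
-- 110.
clause-count : ∀ d u → 2 ≤ d → 1 ≤ u → 2 ^ u ≤ 2 * d → 2 ^ (suc (18 * u * 3) * 1) ≤ d ^ 110
clause-count d u 2≤d 1≤u 2^u≤2d = begin
  2 ^ (suc (18 * u * 3) * 1) ≤⟨ ^-monoʳ-≤ 2 exponent ⟩
  2 ^ (u * 55)               ≡⟨ ^-*-assoc 2 u 55 ⟨
  (2 ^ u) ^ 55               ≤⟨ ^-monoˡ-≤ 55 2^u≤d² ⟩
  (d ^ 2) ^ 55               ≡⟨ ^-*-assoc d 2 55 ⟩
  d ^ 110                    ∎
  where
  open ≤-Reasoning
  collect : ∀ u → u + 18 * u * 3 ≡ u * 55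
  collect = solve-∀
  exponent : suc (18 * u * 3) * 1 ≤ u * 55
  exponent = begin
    suc (18 * u * 3) * 1 ≡⟨ *-identityʳ _ ⟩
    1 + 18 * u * 3       ≤⟨ +-monoˡ-≤ (18 * u * 3) 1≤u ⟩
    u + 18 * u * 3       ≡⟨ collect u ⟩
    u * 55               ∎
  2^u≤d² : 2 ^ u ≤ d ^ 2
  2^u≤d² = begin
    2 ^ u        ≤⟨ 2^u≤2d ⟩
    2 * d        ≤⟨ *-monoˡ-≤ d 2≤d ⟩
    d * d        ≡⟨ cong (d *_) (*-identityʳ d) ⟨
    d ^ 2        ∎

theorem1p2 : (p q : ℕ) → 1 ≤ p → 1 ≤ q →
    Σ[ a ∈ ℕ ] Σ[ b ∈ ℕ ] Σ[ a′ ∈ ℕ ] Σ[ b′ ∈ ℕ ] Σ[ d₀ ∈ ℕ ]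
    (1 ≤ a × 1 ≤ b × 1 ≤ a′ × 1 ≤ b′ ×
    ((d : ℕ) → d₀ ≤ d →
    Σ[ m ∈ ℕ ] Σ[ n ∈ ℕ ] Σ[ G ∈ BipGraph m n ]
    (1 ≤ m + n × K22Free G ×
    (a * (m + n)) ^ q * d ^ q ≤ (2 * numEdges G * b) ^ q * d ^ p ×
    Σ[ k ∈ ℕ ] (2 ^ (k * b′) ≤ d ^ a′ × HasCNF G k))))
-- Here ε = `p/q`, c = `a/b` = 1/2, and C = `a′/b′` = 110 for logarithms to base two. The choice d₀
-- = 2 gives `2 * d ≤ d * d` and makes `u` positive.
theorem1p2 p q _ _ = 1 , 2 , 110 , 1 , 2 , s≤s z≤n , s≤s z≤n , s≤s z≤n , s≤s z≤n , graph
  where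
  graph : (d : ℕ) → 2 ≤ d → Σ[ m ∈ ℕ ] Σ[ n ∈ ℕ ] Σ[ G ∈ BipGraph m n ]
    (1 ≤ m + n × K22Free G ×
    (1 * (m + n)) ^ q * d ^ q ≤ (2 * numEdges G * 2) ^ q * d ^ p ×
    Σ[ k ∈ ℕ ] (2 ^ (k * 1) ≤ d ^ 110 × HasCNF G k))
  graph d 2≤d =
    let 1≤d = ≤-trans (n≤1+n 1) 2≤d
        u , d≤2^u , 2^u≤2d = log₂-approx d 1≤d
        1≤u = n≢0⇒n>0 (λ u≡0 → <⇒≱ 2≤d (subst (λ u → d ≤ 2 ^ u) u≡0 d≤2^u))
        V , G , 1≤V , G-free , cnf , edges = exponentialDegreeGraph u 1≤u
    in V , V , G , ≤-trans 1≤V (m≤m+n V V) , G-free ,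
       average-degree V (numEdges G) d (2 ^ u) p q {{>-nonZero 1≤d}} d≤2^u edges ,
       suc (18 * u * 3) , clause-count d u 2≤d 1≤u 2^u≤2d , cnf
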